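{- The characteristic polynomial $\chi(P;z)$ of polymatroids $P$ is not, in general, a specialization of the polymatroid Tutte polynomial $\mathcal{T}_P$.
   Context: A polymatroid is a pair $P=(E,r)$ with $E$ a finite set and $r:2^E\to\mathbb{Z}$ such that $r(\emptyset)=0$, $r(A)\le r(B)$ whenever $A\subseteq B$, and $r(A)+r(B)\ge r(A\cup B)+r(A\cap B)$ for all $A,B\subseteq E$. Characteristic polynomial: $\chi(P;z)=\sum_{A\subseteq E}(-1)^{|A|}z^{r(E)-r(A)}$. The polymatroid Tutte polynomial $\mathcal{T}_P(x,y)\in\mathbb{Z}[x,y]$ (Bernardi–Kálmán–Postnikov) is given recursively: $\mathcal{T}_P=1$ if $E=\emptyset$. Otherwise fix any $e\in E$, set $\alpha_e=r(E)-r(E\setminus\{e\})$, $\beta_e=r(\{e\})$, and for each integer $\alpha_e\le j\le\beta_e$ let $P_{e,j}$ be the polymatroid on $E\setminus\{e\}$ with rank function $r_{e,j}(A)=\min\{r(A),\,r(A\cup\{e\})-j\}$ (so $P_{e,\alpha_e}=P\setminus e$ is the deletion and $P_{e,\beta_e}=P/e$ the contraction). Then $\mathcal{T}_P=(x+y-1)\mathcal{T}_{P\setminus e}$ if $\alpha_e=\beta_e$, and $\mathcal{T}_P=x\,\mathcal{T}_{P\setminus e}+y\,\mathcal{T}_{P/e}+\sum_{j=\alpha_e+1}^{\beta_e-1}\mathcal{T}_{P_{e,j}}$ if $\alpha_e<\beta_e$. It is known that the result is independent of the choices of $e$. Meaning of "specialization": the word is used informally, for an invariant that can be obtained from $\mathcal{T}_P$.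 Non-specialization is derived from the fact that $\chi$ is not determined by $\mathcal{T}_P$, by means of the following pair. A hypergraph $H=(V,E)$ has an associated polymatroid $P_H=(E,r)$ with $r(A)=|V|-\kappa(A)$, where $\kappa(A)$ is the number of connected components of the hypergraph $(V,A)$. On $V=\{a,b,c,d,e,f,g,h\}$ let $H_3$ have edges $\{a,b,c,h\},\{a,b,d,h\},\{a,b,e,h\},\{a,c,f,h\},\{a,d,g,h\}$ and let $H_4$ have edges $\{a,b,c,h\},\{a,b,d,h\},\{a,b,e,h\},\{a,c,f,h\},\{a,f,g,h\}$. Both associated polymatroids have $5$ elements and rank $7$, and $\mathcal{T}_{P_{H_3}}=\mathcal{T}_{P_{H_4}}$, but $\chi(P_{H_3};z)=z^7-5z^4+5z^3-z$ and $\chi(P_{H_4};z)=z^7-5z^4+5z^3+z^2-3z+1$. -}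

module Defs where

open import Data.Bool.Base using (if_then_else_)
open import Data.Fin.Base using (Fin; zero; suc)
open import Data.Fin.Subset using (Subset; inside; outside; ⊥; ⊤; ⁅_⁆; ∁; _⊆_; _∪_; _∩_)
  renaming (∣_∣ to card)
open import Data.Integer.Base
  using (ℤ; 0ℤ; 1ℤ; -1ℤ; +_; ∣_∣; _+_; _-_; _*_; _^_; _⊓_; _≤_)
open import Data.Integer.Properties using (_≟_)
open import Data.List.Base
  using (List; []; _∷_; _++_; map; foldr; applyUpTo; cartesianProductWith)
open import Data.Nat.Base as ℕ using (ℕ; zero; suc)
open import Data.Nat.Properties as ℕₚ using ()
open import Data.Product.Base using (_×_; _,_; Σ-syntax)
open import Data.Vec.Base as Vec using (Vec; []; _∷_; insertAt; replicate; zipWith; _[_]≔_)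
open import Data.Vec.Properties using (≡-dec)
open import Relation.Binary.PropositionalEquality using (_≡_)
open import Relation.Nullary.Decidable using (does)

-- A polynomial in k variables over ℤ is a formal list of terms
-- (coefficient , exponent vector).  The same exponent vector may occur several
-- times, so polynomials are compared with _≈_ and not with _≡_.

Poly : ℕ → Set
Poly k = List (ℤ × Vec ℕ k)

coeff : ∀ {k} → Poly k → Vec ℕ k → ℤ
coeff []            m = 0ℤ
coeff ((c , e) ∷ p) m = (if does (≡-dec ℕₚ._≟_ e m) then c else 0ℤ) + coeff p m

infix 4 _≈_
_≈_ : ∀ {k} → Poly k → Poly k → Set
p ≈ q = ∀ m → coeff p m ≡ coeff q m

const : ∀ {k} → ℤ → Poly k
const c = (c , replicate _ 0) ∷ []

var : ∀ {k} → Fin k → Poly k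
var i = (1ℤ , replicate _ 0 [ i ]≔ 1) ∷ []

infixl 6 _⊕_
_⊕_ : ∀ {k} → Poly k → Poly k → Poly k
_⊕_ = _++_

infixl 7 _⊗_
_⊗_ : ∀ {k} → Poly k → Poly k → Poly k
_⊗_ = cartesianProductWith λ (c , e) (d , f) → (c * d , zipWith ℕ._+_ e f)

sumₚ : ∀ {k} → List (Poly k) → Poly k
sumₚ = foldr _⊕_ (const 0ℤ)

x y : Poly 2
x = var zero
y = var (suc zero)

record Polymatroid (n : ℕ) : Set where
  field
    rank          : Subset n → ℤ
    rank-∅        : rank ⊥ ≡ 0ℤ
    rank-monotone : ∀ A B → A ⊆ B → rank A ≤ rank B
    rank-submod   : ∀ A B → rank (A ∪ B) + rank (A ∩ B) ≤ rank A + rank B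

open Polymatroid public

subsets : ∀ n → List (Subset n)
subsets zero    = [] ∷ []
subsets (suc n) = map (outside ∷_) (subsets n) ++ map (inside ∷_) (subsets n)

-- The exponent r(E) - r(A) is nonnegative by monotonicity, so ∣_∣ only converts
-- it to a natural number.

χ : ∀ {n} → Polymatroid n → Poly 1
χ {n} P = map (λ A → (-1ℤ ^ card A , ∣ rank P ⊤ - rank P A ∣ ∷ [])) (subsets n)

-- The next functions act on bare rank functions.  A subset of E ∖ {e} is a
-- Subset n, and  insertAt A e s  is the corresponding subset of E, without e
-- (s = outside) or with e (s = inside).

module _ {n : ℕ} (r : Subset (suc n) → ℤ) (e : Fin (suc n)) where

  α β : ℤ
  α = r ⊤ - r (∁ ⁅ e ⁆)
  β = r ⁅ e ⁆

  slice : ℤ → Subset n → ℤ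
  slice j A = r (insertAt A e outside) ⊓ (r (insertAt A e inside) - j)

  deletion contraction : Subset n → ℤ
  deletion    = slice α
  contraction = slice β

  -- The integers j with α < j < β.  For a polymatroid α ≤ β, and when α < β
  -- there are β - α - 1 of them.
  strictlyBetween : List ℤ
  strictlyBetween = applyUpTo (λ i → α + + suc i) (∣ β - α ∣ ℕ.∸ 1)

-- The result does not depend on which element is removed at each step; the
-- recursion always removes the first one.  Started at a polymatroid, it only
-- meets rank functions of polymatroids.

tutteRank : ∀ n → (Subset n → ℤ) → Poly 2
tutteRank zero    r = const 1ℤ
tutteRank (suc n) r =
  if does (α r zero ≟ β r zero)
  then (x ⊕ y ⊕ const -1ℤ) ⊗ tutteRank n (deletion r zero)
  else x ⊗ tutteRank n (deletion r zero)
     ⊕ y ⊗ tutteRank n (contraction r zero)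
     ⊕ sumₚ (map (λ j → tutteRank n (slice r zero j)) (strictlyBetween r zero))

tutte : ∀ {n} → Polymatroid n → Poly 2
tutte {n} P = tutteRank n (rank P)

-- An invariant is a specialization of the Tutte polynomial if it can be
-- computed from it.  As in the usual formulas for specializations, which carry
-- prefactors such as (-1)^r(E), the recipe Φ may also use |E| and r(E).  It has
-- to depend on the polynomial itself and not on its presentation as a list.

IsTutteSpecialization : (∀ {n} → Polymatroid n → Poly 1) → Set
IsTutteSpecialization f =
  Σ[ Φ ∈ (ℕ → ℤ → Poly 2 → Poly 1) ]
    (∀ n ρ p q → p ≈ q → Φ n ρ p ≈ Φ n ρ q) ×
    (∀ {n} (P : Polymatroid n) → f P ≈ Φ n (rank P ⊤) (tutte P))

{-# OPTIONS --safe #-}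

-- The Tutte polynomial is unchanged when the base polytope is translated, whereas
-- χ depends on its position.  The smallest instance: a rank function
-- A ↦ Σ_{e ∈ A} w e has a single base w, so its Tutte polynomial is (x + y - 1)^|E|
-- for every w.  On two elements the weights (1 , 1) and (2 , 0) both have rank 2,
-- but χ is z² - 2z + 1 for the first and 0 for the second, which has a loop.

module Submission where

open import Defs
open import Algebra.Properties.CommutativeSemigroup using (interchange)
open import Data.Bool.Base using (Bool; true; false; if_then_else_; _∨_; _∧_)
open import Data.Fin.Subset using (Subset; ⊥; _⊆_; _∪_; _∩_)
open import Data.Fin.Subset.Properties using (drop-∷-⊆)
open import Data.Integer.Base using (+_; +≤+)
open import Data.Integer.Properties as ℤₚ using ()
open import Data.Nat.Base using (ℕ; _+_; _≤_; z≤n)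
open import Data.Nat.Properties
  using (+-mono-≤; ≤-refl; +-identityʳ; +-commutativeSemigroup)
open import Data.Product.Base using (_,_)
open import Data.Vec.Base using (Vec; []; _∷_; here)
open import Relation.Binary.PropositionalEquality
  using (_≡_; refl; sym; trans; cong; cong₂)
open import Relation.Nullary using (¬_)

weight : ∀ {n} → Vec ℕ n → Subset n → ℕ
weight []       []      = 0
weight (w ∷ ws) (s ∷ A) = (if s then w else 0) + weight ws A

weight-⊥ : ∀ {n} (ws : Vec ℕ n) → weight ws ⊥ ≡ 0
weight-⊥ []       = refl
weight-⊥ (w ∷ ws) = weight-⊥ ws

-- Weights are natural numbers, so extra elements never lower the total.
weight-mono : ∀ {n} (ws : Vec ℕ n) A B → A ⊆ B → weight ws A ≤ weight ws B
weight-mono []       []          []      A⊆B = z≤n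
weight-mono (w ∷ ws) (false ∷ A) (t ∷ B) A⊆B =
  +-mono-≤ {0} z≤n (weight-mono ws A B (drop-∷-⊆ A⊆B))
weight-mono (w ∷ ws) (true ∷ A)  (t ∷ B) A⊆B with A⊆B here
-- Matching on `here` forces `t` to be `true`, so both heads contribute `w`.
... | here = +-mono-≤ {w} ≤-refl (weight-mono ws A B (drop-∷-⊆ A⊆B))

if-∨-∧ : ∀ (s t : Bool) w →
  (if s ∨ t then w else 0) + (if s ∧ t then w else 0)
    ≡ (if s then w else 0) + (if t then w else 0)
if-∨-∧ false t w = +-identityʳ _
if-∨-∧ true  t w = refl

weight-modular : ∀ {n} (ws : Vec ℕ n) A B →
  weight ws (A ∪ B) + weight ws (A ∩ B) ≡ weight ws A + weight ws B
weight-modular []       []      []      = refl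
weight-modular (w ∷ ws) (s ∷ A) (t ∷ B) =
  -- `medial` regroups four summands, separating the head element from the tail before the two cases
  -- are combined and back again after.
  trans (medial (if s ∨ t then w else 0) _ (if s ∧ t then w else 0) _)
    (trans (cong₂ _+_ (if-∨-∧ s t w) (weight-modular ws A B))
      (medial (if s then w else 0) (if t then w else 0) _ _))
  where medial = interchange +-commutativeSemigroup

modular : ∀ {n} → Vec ℕ n → Polymatroid n
modular ws = record
  { rank          = λ A → + weight ws A
  ; rank-∅        = cong +_ (weight-⊥ ws)
  ; rank-monotone = λ A B A⊆B → +≤+ (weight-mono ws A B A⊆B)
  ; rank-submod   = λ A B → ℤₚ.≤-reflexive (cong +_ (weight-modular ws A B))
  }

corollary6p4 : ¬ IsTutteSpecialization χ
-- Both ranks compute to 2 and both Tutte polynomials to the same list of terms, so the two values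
-- of `Φ` agree definitionally. The constant coefficients of `χ` differ: 1 from the full set alone
-- for `free`, and 1 - 1 for `loop`, where the weight-2 singleton also has full rank.
corollary6p4 (Φ , _ , χ≈Φ) = 1≢0 (trans (χ≈Φ free (0 ∷ [])) (sym (χ≈Φ loop (0 ∷ []))))
  where
  free loop : Polymatroid 2
  free = modular (1 ∷ 1 ∷ [])
  loop = modular (2 ∷ 0 ∷ [])

  1≢0 : ¬ (+ 1 ≡ + 0)
  1≢0 ()
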